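{- Let $K$ be a commutative field and $L$ a (possibly noncommutative) division ring containing $K$ in its center such that every element of $L\setminus K$ is transcendental over $K$. Let $A,B$ be nonzero finite-dimensional $K$-subspaces of $L$. Then $\dim_K\langle AB\rangle\geq\dim_KA+\dim_KB-1$.
   Context: For $S\subset L$, $\langle S\rangle$ denotes the $K$-subspace of $L$ spanned by $S$; $AB=\{ab\mid a\in A,b\in B\}$. -}

module Defs where

open import Algebra.Bundles using (Ring; CommutativeRing)
import Algebra.Definitions as AlgebraDefinitions
import Algebra.Properties.CommutativeMonoid.Sum as Sum
import Algebra.Properties.Semiring.Exp as Exp
open import Algebra.Module.Bundles using (LeftModule)
open import Algebra.Morphism.Structures using (IsRingMonomorphism)
open import Data.Fin.Base using (toℕ)
open import Data.Nat.Base using (ℕ)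
open import Data.Product.Base using (∃; ∃-syntax; Σ-syntax; _×_)
open import Data.Vec.Functional using (Vector)
open import Level using (Level; _⊔_)
open import Relation.Nullary.Negation.Core using (¬_)
open import Relation.Unary using (Pred; _∈_)

private
  variable
    a b c ℓ m ℓm p q : Level

record IsDivisionRing (R : Ring c ℓ) : Set (c ⊔ ℓ) where
  open Ring R
  open AlgebraDefinitions _≈_ using (Invertible)
  field
    1≉0     : ¬ 1# ≈ 0#
    inverse : ∀ x → ¬ x ≈ 0# → Invertible 1# _*_ x

IsField : CommutativeRing c ℓ → Set (c ⊔ ℓ)
IsField R = IsDivisionRing (CommutativeRing.ring R)

module LinearAlgebra {R : Ring c ℓ} (M : LeftModule R m ℓm) where
  open Ring R using (Carrier; _≈_; 0#)
  open LeftModule M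
  open Sum +ᴹ-commutativeMonoid using (sum)

  record IsSubspace (V : Pred Carrierᴹ p) : Set (c ⊔ m ⊔ ℓm ⊔ p) where
    field
      resp-≈ : ∀ {x y} → x ≈ᴹ y → x ∈ V → y ∈ V
      0-mem  : 0ᴹ ∈ V
      +-mem  : ∀ {x y} → x ∈ V → y ∈ V → (x +ᴹ y) ∈ V
      *-mem  : ∀ k {x} → x ∈ V → (k *ₗ x) ∈ V

  Nonzero : Pred Carrierᴹ p → Set (m ⊔ ℓm ⊔ p)
  Nonzero V = ∃[ x ] x ∈ V × ¬ x ≈ᴹ 0ᴹ

  linearCombination : ∀ {n} → Vector Carrier n → Vector Carrierᴹ n → Carrierᴹ
  linearCombination k v = sum (λ i → k i *ₗ v i)

  ⟨_⟩ : Pred Carrierᴹ p → Pred Carrierᴹ (c ⊔ m ⊔ ℓm ⊔ p)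
  ⟨ S ⟩ x = Σ[ n ∈ ℕ ] Σ[ k ∈ Vector Carrier n ] Σ[ v ∈ Vector Carrierᴹ n ]
              (∀ i → v i ∈ S) × x ≈ᴹ linearCombination k v

  LinearlyDependent : ∀ {n} → Vector Carrierᴹ n → Set (c ⊔ ℓ ⊔ ℓm)
  LinearlyDependent {n} v =
    Σ[ k ∈ Vector Carrier n ]
      (∃[ i ] ¬ k i ≈ 0#) × linearCombination k v ≈ᴹ 0ᴹ

  -- Independence is the absence of a nontrivial relation.  As _≈_ need not be
  -- ¬¬-stable, this is constructively weaker than asking that every relation
  -- have all its coefficients equal to 0#.
  LinearlyIndependent : ∀ {n} → Vector Carrierᴹ n → Set (c ⊔ ℓ ⊔ ℓm)
  LinearlyIndependent v = ¬ LinearlyDependent v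

  record IsBasis (V : Pred Carrierᴹ p) {n} (e : Vector Carrierᴹ n)
                 : Set (c ⊔ ℓ ⊔ m ⊔ ℓm ⊔ p) where
    field
      member      : ∀ i → e i ∈ V
      independent : LinearlyIndependent e
      spanning    : ∀ {x} → x ∈ V →
                    Σ[ k ∈ Vector Carrier n ] x ≈ᴹ linearCombination k e

  HasDimension : Pred Carrierᴹ p → ℕ → Set (c ⊔ ℓ ⊔ m ⊔ ℓm ⊔ p)
  HasDimension V n = Σ[ e ∈ Vector Carrierᴹ n ] IsBasis V e

  FiniteDimensional : Pred Carrierᴹ p → Set (c ⊔ ℓ ⊔ m ⊔ ℓm ⊔ p)
  FiniteDimensional V = ∃[ n ] HasDimension V n

record CentralEmbedding (K : CommutativeRing a b) (L : Ring c ℓ)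
                        : Set (a ⊔ b ⊔ c ⊔ ℓ) where
  private
    module K = CommutativeRing K
  open Ring L
  open Sum +-commutativeMonoid using (sum)
  open Exp semiring using (_^_)

  field
    ι                  : K.Carrier → Carrier
    isRingMonomorphism : IsRingMonomorphism K.rawRing rawRing ι
    central            : ∀ k x → (ι k * x) ≈ (x * ι k)

  open IsRingMonomorphism isRingMonomorphism

  asModule : LeftModule K.ring c ℓ
  asModule = record
    { Carrierᴹ = Carrier
    ; _≈ᴹ_     = _≈_
    ; _+ᴹ_     = _+_
    ; _*ₗ_     = λ k x → ι k * x
    ; 0ᴹ       = 0#
    ; -ᴹ_      = -_
    ; isLeftModule = record
      { isLeftSemimodule = record
        { +ᴹ-isCommutativeMonoid = +-isCommutativeMonoid
        ; isPreleftSemimodule = record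
          { *ₗ-cong      = λ k≈l x≈y → *-cong (⟦⟧-cong k≈l) x≈y
          ; *ₗ-zeroˡ     = λ x → trans (*-congʳ 0#-homo) (zeroˡ x)
          ; *ₗ-distribʳ  = λ x k l → trans (*-congʳ (+-homo k l)) (distribʳ x (ι k) (ι l))
          ; *ₗ-identityˡ = λ x → trans (*-congʳ 1#-homo) (*-identityˡ x)
          ; *ₗ-assoc     = λ k l x → trans (*-congʳ (*-homo k l)) (*-assoc (ι k) (ι l) x)
          ; *ₗ-zeroʳ     = λ k → zeroʳ (ι k)
          ; *ₗ-distribˡ  = λ k x y → distribˡ (ι k) x y
          }
        }
      ; -ᴹ‿cong    = -‿cong
      ; -ᴹ‿inverse = -‿inverse
      }
    }

  Image : Pred Carrier (a ⊔ ℓ)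
  Image x = ∃[ k ] ι k ≈ x

  -- The vector (p₀ , … , pₙ₋₁) stands for the polynomial Σ pᵢ Xⁱ.
  eval : ∀ {n} → Vector K.Carrier n → Carrier → Carrier
  eval p x = sum (λ i → ι (p i) * (x ^ toℕ i))

  Algebraic : Pred Carrier (a ⊔ b ⊔ ℓ)
  Algebraic x = Σ[ n ∈ ℕ ] Σ[ p ∈ Vector K.Carrier n ]
                  (∃[ i ] ¬ p i K.≈ K.0#) × eval p x ≈ 0#

  Transcendental : Pred Carrier (a ⊔ b ⊔ ℓ)
  Transcendental x = ¬ Algebraic x

  _·_ : Pred Carrier p → Pred Carrier q → Pred Carrier (c ⊔ ℓ ⊔ p ⊔ q)
  (A · B) x = ∃[ y ] ∃[ z ] y ∈ A × z ∈ B × x ≈ (y * z)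

  open LinearAlgebra asModule public

{-# OPTIONS --safe #-}
module Submission where

-- Suppose dim⟨AB⟩ ≤ dim A + dim B - 2 and fix nonzero u ∈ A, v ∈ B.  Then A v and
-- u B meet in dimension at least 2 inside ⟨AB⟩, so u' v = u v' for some u' ∈ A and
-- v' ∈ B with u' v ∉ K u v.  Put x = u⁻¹ u', which is not in K, and y = x⁻¹.  Both
-- pairs (A ∩ A x, B + y B) and (A + A x, B ∩ y B) consist of nonzero spaces whose
-- products lie in ⟨AB⟩, and their four dimensions add up to 2 (dim A + dim B).  As y
-- is transcendental, A is not stable under right multiplication
-- by y, so A ∩ A x is smaller than A.  Hence
-- one of the pairs has a larger dimension sum, or the first has the same sum and a
-- smaller left space; since sums are at most 2 dim⟨AB⟩, this cannot go on forever.
--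
-- Equality in K and L is not decidable, so bases and case distinctions are only
-- available under ¬ ¬, which suffices as the inequality itself is decidable.

open import Defs
open import Algebra.Bundles using (Ring; CommutativeRing; CommutativeMonoid)
open import Algebra.Module.Bundles using (LeftModule)
open import Algebra.Morphism.Structures using (IsRingMonomorphism)
import Algebra.Module.Properties.LeftModule as LeftModuleProperties
import Algebra.Properties.Semiring.Exp as Exp
import Algebra.Properties.CommutativeSemigroup as CommutativeSemigroupProperties
open import Data.Empty using (⊥; ⊥-elim)
open import Data.Fin.Base using (zero; suc; toℕ)
open import Data.List.Base
  using (List; []; _∷_; _++_; [_]; length; map; tabulate; lookup; cartesianProductWith)
open import Data.List.Membership.Propositional using () renaming (_∈_ to _∈ₗ_)
open import Data.List.Membership.Propositional.Properties
  using (∈-++⁺ˡ; ∈-insert; ∈-lookup; ∈-cartesianProductWith⁺; ∈-cartesianProductWith⁻; ∈-tabulate⁻)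
open import Data.List.Properties using (length-map; length-tabulate; tabulate-lookup)
open import Data.List.Relation.Binary.Subset.Propositional using (_⊆_)
open import Data.List.Relation.Binary.Subset.Propositional.Properties using (xs⊆x∷xs; ++⁺ʳ)
open import Data.List.Relation.Unary.All as All using (All; []; _∷_)
import Data.List.Relation.Unary.All.Properties as All
open import Data.List.Relation.Unary.Any using (here; there)
open import Data.Nat.Base using (ℕ; zero; suc; _+_; _∸_; _≥_; _≤_; _<_; z≤n; s≤s)
import Data.Nat.Properties as ℕ
open import Data.Product.Base using (_×_; _,_; proj₁; proj₂; ∃-syntax; Σ-syntax)
open import Data.Sum.Base using (_⊎_; inj₁; inj₂)
open import Data.Unit.Polymorphic.Base using (⊤; tt)
open import Data.Vec.Functional using (Vector)
open import Function.Base using (_∘_; id)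
open import Level using (Level; _⊔_)
open import Relation.Binary.PropositionalEquality as ≡ using (_≡_; refl; cong; subst)
import Relation.Binary.Reasoning.Setoid as SetoidReasoning
open import Relation.Nullary.Decidable.Core using (yes; no; ¬¬-excluded-middle; decidable-stable)
open import Relation.Nullary.Negation.Core using (¬_)
open import Relation.Unary using (Pred; _∈_)

private
  variable
    a b c ℓ m ℓm p q : Level

-- Spans of lists of vectors in a module.

module Span {R : Ring c ℓ} (M : LeftModule R m ℓm) where
  private module R = Ring R
  open LeftModule M
  open LinearAlgebra M
  open LeftModuleProperties M using (inverseʳ-uniqueᴹ)
  open SetoidReasoning ≈ᴹ-setoid

  +-interchange : ∀ {w x y z} → (w +ᴹ x) +ᴹ (y +ᴹ z) ≈ᴹ (w +ᴹ y) +ᴹ (x +ᴹ z)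
  +-interchange = CommutativeSemigroupProperties.interchange
    (CommutativeMonoid.commutativeSemigroup +ᴹ-commutativeMonoid) _ _ _ _

  +-move : ∀ {x y z} → x ≈ᴹ y +ᴹ z → x +ᴹ -ᴹ z ≈ᴹ y
  +-move {x} {y} {z} x≈y+z = begin
    x +ᴹ -ᴹ z            ≈⟨ +ᴹ-congʳ x≈y+z ⟩
    (y +ᴹ z) +ᴹ -ᴹ z     ≈⟨ +ᴹ-assoc y z _ ⟩
    y +ᴹ (z +ᴹ -ᴹ z)     ≈⟨ +ᴹ-congˡ (-ᴹ‿inverseʳ z) ⟩
    y +ᴹ 0ᴹ              ≈⟨ +ᴹ-identityʳ y ⟩
    y                    ∎

  -1*x≈-x : ∀ x → (R.- R.1#) *ₗ x ≈ᴹ -ᴹ x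
  -1*x≈-x x = inverseʳ-uniqueᴹ x _ (begin
    x +ᴹ (R.- R.1#) *ₗ x            ≈⟨ +ᴹ-congʳ (*ₗ-identityˡ x) ⟨
    R.1# *ₗ x +ᴹ (R.- R.1#) *ₗ x    ≈⟨ *ₗ-distribʳ x _ _ ⟨
    (R.1# R.+ (R.- R.1#)) *ₗ x      ≈⟨ *ₗ-congʳ (R.-‿inverseʳ R.1#) ⟩
    R.0# *ₗ x                       ≈⟨ *ₗ-zeroˡ x ⟩
    0ᴹ                              ∎)

  -‿mem : ∀ {V : Pred Carrierᴹ p} → IsSubspace V → ∀ {x} → V x → V (-ᴹ x)
  -‿mem V-sub {x} x∈V = resp-≈ (-1*x≈-x x) (*-mem _ x∈V)
    where open IsSubspace V-sub

  -- Coefficients are peeled off one list entry at a time, so facts about spans go by induction on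
  -- the derivation instead of by reindexing finite families.
  data Span : List Carrierᴹ → Pred Carrierᴹ (c ⊔ m ⊔ ℓm) where
    nil  : ∀ {x} → x ≈ᴹ 0ᴹ → Span [] x
    cons : ∀ {v vs x y} (k : R.Carrier) → Span vs y → x ≈ᴹ k *ₗ v +ᴹ y → Span (v ∷ vs) x

  span-isSubspace : ∀ vs → IsSubspace (Span vs)
  span-isSubspace vs = record { resp-≈ = resp ; 0-mem = zer vs ; +-mem = add ; *-mem = scale }
    where
    resp : ∀ {vs x y} → x ≈ᴹ y → Span vs x → Span vs y
    resp x≈y (nil x≈0)    = nil (≈ᴹ-trans (≈ᴹ-sym x≈y) x≈0)
    resp x≈y (cons k s e) = cons k s (≈ᴹ-trans (≈ᴹ-sym x≈y) e)

    zer : ∀ vs → Span vs 0ᴹ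
    zer []       = nil ≈ᴹ-refl
    zer (v ∷ vs) = cons R.0# (zer vs)
      (≈ᴹ-sym (≈ᴹ-trans (+ᴹ-identityʳ _) (*ₗ-zeroˡ v)))

    add : ∀ {vs x y} → Span vs x → Span vs y → Span vs (x +ᴹ y)
    add (nil e) (nil e′) = nil (≈ᴹ-trans (+ᴹ-cong e e′) (+ᴹ-identityˡ 0ᴹ))
    add (cons {v = v} k s e) (cons l t e′) = cons (k R.+ l) (add s t)
      (≈ᴹ-trans (+ᴹ-cong e e′)
        (≈ᴹ-trans +-interchange (+ᴹ-congʳ (≈ᴹ-sym (*ₗ-distribʳ v k l)))))

    scale : ∀ {vs} k {x} → Span vs x → Span vs (k *ₗ x)
    scale k (nil e) = nil (≈ᴹ-trans (*ₗ-congˡ e) (*ₗ-zeroʳ k))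
    scale k (cons {v = v} l s e) = cons (k R.* l) (scale k s)
      (≈ᴹ-trans (*ₗ-congˡ e)
        (≈ᴹ-trans (*ₗ-distribˡ k _ _) (+ᴹ-congʳ (≈ᴹ-sym (*ₗ-assoc k l v)))))

  module Sp {vs} = IsSubspace (span-isSubspace vs)

  span-weaken : ∀ {v vs x} → Span vs x → Span (v ∷ vs) x
  span-weaken {v} {x = x} s = cons R.0# s
    (≈ᴹ-sym (≈ᴹ-trans (+ᴹ-congʳ (*ₗ-zeroˡ v)) (+ᴹ-identityˡ x)))

  span-head : ∀ {v vs} → Span (v ∷ vs) v
  span-head {v} = cons R.1# Sp.0-mem
    (≈ᴹ-sym (≈ᴹ-trans (+ᴹ-identityʳ _) (*ₗ-identityˡ v)))

  ∈⇒span : ∀ {v vs} → v ∈ₗ vs → Span vs v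
  ∈⇒span (here refl)  = span-head
  ∈⇒span (there v∈vs) = span-weaken (∈⇒span v∈vs)

  span-least : ∀ {V : Pred Carrierᴹ p} → IsSubspace V → ∀ {vs} → All V vs →
               ∀ {x} → Span vs x → V x
  span-least V-sub []           (nil e)      = resp-≈ (≈ᴹ-sym e) 0-mem
    where open IsSubspace V-sub
  span-least V-sub (v∈V ∷ vs⊆V) (cons k s e) =
    resp-≈ (≈ᴹ-sym e) (+-mem (*-mem k v∈V) (span-least V-sub vs⊆V s))
    where open IsSubspace V-sub

  span-⊆ : ∀ {vs ws} → All (Span ws) vs → ∀ {x} → Span vs x → Span ws x
  span-⊆ = span-least (span-isSubspace _)

  span-mono : ∀ {vs ws} → vs ⊆ ws → ∀ {x} → Span vs x → Span ws x
  span-mono vs⊆ws = span-⊆ (All.tabulate (∈⇒span ∘ vs⊆ws))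

  -- Serves `transcendental-unstable`, where a space is stable under multiplication only up to ¬ ¬.
  ¬¬-isSubspace : ∀ {V : Pred Carrierᴹ p} → IsSubspace V → IsSubspace (λ x → ¬ ¬ V x)
  ¬¬-isSubspace V-sub = record
    { resp-≈ = λ x≈y ¬¬x ¬y → ¬¬x (¬y ∘ resp-≈ x≈y)
    ; 0-mem  = λ ¬0 → ¬0 0-mem
    ; +-mem  = λ ¬¬x ¬¬y ¬x+y → ¬¬x λ x∈V → ¬¬y λ y∈V → ¬x+y (+-mem x∈V y∈V)
    ; *-mem  = λ k ¬¬x ¬kx → ¬¬x (¬kx ∘ *-mem k)
    }
    where open IsSubspace V-sub

  -- Independence, sums and intersections of subspaces.

  _⊞_ : Pred Carrierᴹ p → Pred Carrierᴹ q → Pred Carrierᴹ (m ⊔ ℓm ⊔ p ⊔ q)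
  (U ⊞ V) x = ∃[ u ] ∃[ v ] U u × V v × x ≈ᴹ u +ᴹ v

  ⊞-isSubspace : ∀ {U : Pred Carrierᴹ p} {V : Pred Carrierᴹ q} →
                 IsSubspace U → IsSubspace V → IsSubspace (U ⊞ V)
  ⊞-isSubspace U-sub V-sub = record
    { resp-≈ = λ x≈y (u , v , u∈ , v∈ , e) → u , v , u∈ , v∈ , ≈ᴹ-trans (≈ᴹ-sym x≈y) e
    ; 0-mem  = 0ᴹ , 0ᴹ , U.0-mem , V.0-mem , ≈ᴹ-sym (+ᴹ-identityˡ 0ᴹ)
    ; +-mem  = λ (u , v , u∈ , v∈ , e) (u′ , v′ , u′∈ , v′∈ , e′) →
        u +ᴹ u′ , v +ᴹ v′ , U.+-mem u∈ u′∈ , V.+-mem v∈ v′∈ ,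
        ≈ᴹ-trans (+ᴹ-cong e e′) +-interchange
    ; *-mem  = λ k (u , v , u∈ , v∈ , e) →
        k *ₗ u , k *ₗ v , U.*-mem k u∈ , V.*-mem k v∈ ,
        ≈ᴹ-trans (*ₗ-congˡ e) (*ₗ-distribˡ k u v)
    }
    where module U = IsSubspace U-sub
          module V = IsSubspace V-sub

  -- A triangular form of independence: adding a vector costs one condition against the span of
  -- those already present. Over a division ring it is tied to `LinearlyIndependent` by
  -- `independent⇒indep` and `indep⇒independent`.
  Indep : List Carrierᴹ → Set (c ⊔ m ⊔ ℓm)
  Indep []       = ⊤
  Indep (v ∷ vs) = ¬ Span vs v × Indep vs

  indep-[_] : ∀ {x} → ¬ x ≈ᴹ 0ᴹ → Indep [ x ]
  indep-[ x≉0 ] = (λ { (nil x≈0) → x≉0 x≈0 }) , tt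

  ¬span⇒≉0 : ∀ {vs x} → ¬ Span vs x → ¬ x ≈ᴹ 0ᴹ
  ¬span⇒≉0 x∉ x≈0 = x∉ (Sp.resp-≈ (≈ᴹ-sym x≈0) Sp.0-mem)

  -- The dimension formula for sum and intersection, with `ys` and `zs` as independent lists in
  -- each. The vectors of `vs` are added one by one. Each `v` either is new to the sum, or equals s
  -- + t with s in U and t in the span of the earlier ones; then s = v - t is new to the
  -- intersection, since otherwise `v` would depend on the earlier ones.
  sum-∩ : ∀ {U : Pred Carrierᴹ p} → IsSubspace U → ∀ {us} → All U us → Indep us →
          ∀ vs → Indep vs →
          ¬ ¬ (∃[ ys ] ∃[ zs ]
                Indep ys × All (U ⊞ Span vs) ys ×
                Indep zs × All U zs × All (Span vs) zs ×
                length us ≤ length ys ×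
                length ys + length zs ≡ length us + length vs)
  sum-∩ {U = U} U-sub {us} us⊆U us-ind [] _ done =
    done (us , [] , us-ind , All.map inU us⊆U , tt , [] , [] , ℕ.≤-refl , refl)
    where
    inU : ∀ {x} → U x → (U ⊞ Span []) x
    inU x∈U = _ , 0ᴹ , x∈U , Sp.0-mem , ≈ᴹ-sym (+ᴹ-identityʳ _)
  sum-∩ {U = U} U-sub {us} us⊆U us-ind (v ∷ vs) (v∉ , vs-ind) done =
    sum-∩ U-sub us⊆U us-ind vs vs-ind
      λ (ys , zs , ys-ind , ys⊆ , zs-ind , zs⊆U , zs⊆V , us≤ys , eq) →
    let grow : ∀ {x} → (U ⊞ Span vs) x → (U ⊞ Span (v ∷ vs)) x
        grow (s , t , s∈ , t∈ , e) = s , t , s∈ , span-weaken t∈ , e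
    in
    ¬¬-excluded-middle λ
    { (no v∉ys) → done
        ( v ∷ ys , zs , (v∉ys , ys-ind)
        , (0ᴹ , v , 0-mem , span-head , ≈ᴹ-sym (+ᴹ-identityˡ v)) ∷ All.map grow ys⊆
        , zs-ind , zs⊆U , All.map span-weaken zs⊆V
        , ℕ.m≤n⇒m≤1+n us≤ys
        , ≡.trans (cong suc eq) (≡.sym (ℕ.+-suc (length us) (length vs))))
    ; (yes v∈ys) →
        let (s , t , s∈U , t∈ , v≈s+t) =
              span-least (⊞-isSubspace U-sub (span-isSubspace vs)) ys⊆ v∈ys
            s∈V = Sp.resp-≈ (+-move v≈s+t)
                    (Sp.+-mem span-head (-‿mem (span-isSubspace _) (span-weaken t∈)))
            s∉zs = λ s∈zs → v∉ (Sp.resp-≈ (≈ᴹ-sym v≈s+t) (Sp.+-mem (span-⊆ zs⊆V s∈zs) t∈))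
        in done
        ( ys , s ∷ zs , ys-ind , All.map grow ys⊆
        , (s∉zs , zs-ind) , s∈U ∷ zs⊆U , s∈V ∷ All.map span-weaken zs⊆V
        , us≤ys
        , ≡.trans (ℕ.+-suc (length ys) (length zs))
            (≡.trans (cong suc eq) (≡.sym (ℕ.+-suc (length us) (length vs)))))
    }
    where open IsSubspace U-sub

  -- `sum-∩` may return an empty `zs`. Putting `[ w ]` in its place keeps everything except the
  -- equation, which becomes an inequality.
  sum-∩-nonzero : ∀ {U : Pred Carrierᴹ p} → IsSubspace U → ∀ {us} → All U us → Indep us →
          ∀ vs → Indep vs → ∀ {w} → U w → Span vs w → ¬ w ≈ᴹ 0ᴹ →
          ¬ ¬ (∃[ ys ] ∃[ zs ]
                Indep ys × All (U ⊞ Span vs) ys ×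
                Indep zs × All U zs × All (Span vs) zs ×
                length us ≤ length ys × 1 ≤ length zs ×
                length us + length vs ≤ length ys + length zs)
  sum-∩-nonzero U-sub {us} us⊆U us-ind vs vs-ind {w} w∈U w∈V w≉0 done =
    sum-∩ U-sub us⊆U us-ind vs vs-ind λ
    { (ys , [] , ys-ind , ys⊆ , _ , _ , _ , us≤ys , eq) → done
        ( ys , [ w ] , ys-ind , ys⊆ , indep-[ w≉0 ] , w∈U ∷ [] , w∈V ∷ []
        , us≤ys , ℕ.≤-refl
        , ℕ.≤-trans (ℕ.≤-reflexive (≡.sym eq)) (ℕ.+-monoʳ-≤ (length ys) z≤n))
    ; (ys , z ∷ zs , ys-ind , ys⊆ , zs-ind , zs⊆U , zs⊆V , us≤ys , eq) → done
        ( ys , z ∷ zs , ys-ind , ys⊆ , zs-ind , zs⊆U , zs⊆V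
        , us≤ys , s≤s z≤n , ℕ.≤-reflexive (≡.sym eq))
    }

  extract-basis : ∀ gs → ¬ ¬ (∃[ es ] Indep es × es ⊆ gs × All (Span es) gs)
  extract-basis []       done = done ([] , tt , id , [])
  extract-basis (g ∷ gs) done = extract-basis gs λ (es , es-ind , es⊆gs , gs⊆es) →
    ¬¬-excluded-middle λ
    { (yes g∈es) → done (es , es-ind , there ∘ es⊆gs , g∈es ∷ gs⊆es)
    ; (no  g∉es) → done
        ( g ∷ es , (g∉es , es-ind)
        , (λ { (here e) → here e ; (there i) → there (es⊆gs i) })
        , span-head ∷ All.map span-weaken gs⊆es)
    }

  -- Linear maps and their effect on spans.

  record IsLinear (f : Carrierᴹ → Carrierᴹ) : Set (c ⊔ m ⊔ ℓm) where
    field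
      f-cong : ∀ {x y} → x ≈ᴹ y → f x ≈ᴹ f y
      +-homo : ∀ x y → f (x +ᴹ y) ≈ᴹ f x +ᴹ f y
      *-homo : ∀ k x → f (k *ₗ x) ≈ᴹ k *ₗ f x

    0-homo : f 0ᴹ ≈ᴹ 0ᴹ
    0-homo = begin
      f 0ᴹ              ≈⟨ f-cong (*ₗ-zeroˡ 0ᴹ) ⟨
      f (R.0# *ₗ 0ᴹ)    ≈⟨ *-homo R.0# 0ᴹ ⟩
      R.0# *ₗ f 0ᴹ      ≈⟨ *ₗ-zeroˡ (f 0ᴹ) ⟩
      0ᴹ                ∎

    combination-homo : ∀ k v y → f (k *ₗ v +ᴹ y) ≈ᴹ k *ₗ f v +ᴹ f y
    combination-homo k v y = ≈ᴹ-trans (+-homo _ y) (+ᴹ-congʳ (*-homo k v))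

    preimage-isSubspace : ∀ {V : Pred Carrierᴹ p} → IsSubspace V → IsSubspace (V ∘ f)
    preimage-isSubspace V-sub = record
      { resp-≈ = resp-≈ ∘ f-cong
      ; 0-mem  = resp-≈ (≈ᴹ-sym 0-homo) 0-mem
      ; +-mem  = λ x∈ y∈ → resp-≈ (≈ᴹ-sym (+-homo _ _)) (+-mem x∈ y∈)
      ; *-mem  = λ k x∈ → resp-≈ (≈ᴹ-sym (*-homo k _)) (*-mem k x∈)
      }
      where open IsSubspace V-sub

    span-map⁻ : ∀ vs {y} → Span (map f vs) y → ∃[ x ] Span vs x × y ≈ᴹ f x
    span-map⁻ []       (nil e)      = 0ᴹ , nil ≈ᴹ-refl , ≈ᴹ-trans e (≈ᴹ-sym 0-homo)
    span-map⁻ (v ∷ vs) (cons k s e) = let (x , x∈ , e′) = span-map⁻ vs s in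
      k *ₗ v +ᴹ x , cons k x∈ ≈ᴹ-refl ,
      ≈ᴹ-trans e (≈ᴹ-trans (+ᴹ-congˡ e′) (≈ᴹ-sym (combination-homo k v x)))

    span-map⁺ : ∀ {vs x} → Span vs x → Span (map f vs) (f x)
    span-map⁺ (nil e)      = nil (≈ᴹ-trans (f-cong e) 0-homo)
    span-map⁺ (cons k s e) = cons k (span-map⁺ s) (≈ᴹ-trans (f-cong e) (combination-homo k _ _))

    module _ (injective : ∀ {x y} → f x ≈ᴹ f y → x ≈ᴹ y) where

      indep-map : ∀ vs → Indep vs → Indep (map f vs)
      indep-map []       _            = tt
      indep-map (v ∷ vs) (v∉ , v-ind) =
        (λ s → let (x , x∈ , e) = span-map⁻ vs s in v∉ (Sp.resp-≈ (≈ᴹ-sym (injective e)) x∈)) ,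
        indep-map vs v-ind

  -- Linear combinations of vectors compared with spans of lists.

  combination-mem : ∀ {V : Pred Carrierᴹ p} → IsSubspace V → ∀ {n} k (v : Vector Carrierᴹ n) →
                    (∀ i → V (v i)) → V (linearCombination k v)
  combination-mem V-sub {zero}  k v v∈ = IsSubspace.0-mem V-sub
  combination-mem V-sub {suc n} k v v∈ =
    +-mem (*-mem (k zero) (v∈ zero)) (combination-mem V-sub (k ∘ suc) (v ∘ suc) (v∈ ∘ suc))
    where open IsSubspace V-sub

  combination⇒span : ∀ {n} k (v : Vector Carrierᴹ n) → Span (tabulate v) (linearCombination k v)
  combination⇒span {zero}  k v = nil ≈ᴹ-refl
  combination⇒span {suc n} k v = cons (k zero) (combination⇒span (k ∘ suc) (v ∘ suc)) ≈ᴹ-refl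

  span⇒combination : ∀ {n} (v : Vector Carrierᴹ n) {x} → Span (tabulate v) x →
                     Σ[ k ∈ Vector R.Carrier n ] x ≈ᴹ linearCombination k v
  span⇒combination {zero}  v (nil e)      = (λ ()) , e
  span⇒combination {suc n} v (cons k s e) =
    let (ks , e′) = span⇒combination (v ∘ suc) s in
    (λ { zero → k ; (suc i) → ks i }) , ≈ᴹ-trans e (+ᴹ-congˡ e′)

  -- Independence and Steinitz exchange over a division ring.

  module _ (R-div : IsDivisionRing R) where
    open IsDivisionRing R-div

    -1≉0 : ¬ (R.- R.1#) R.≈ R.0#
    -1≉0 e = 1≉0 (R.trans (R.sym (R.+-identityʳ R.1#))
                   (R.trans (R.+-congˡ (R.sym e)) (R.-‿inverseʳ R.1#)))

    independent⇒indep : ∀ {n} (v : Vector Carrierᴹ n) → LinearlyIndependent v → Indep (tabulate v)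
    independent⇒indep {zero}  v _   = tt
    independent⇒indep {suc n} v ind =
      (λ s → let (k , e) = span⇒combination (v ∘ suc) s in
        -- A combination equal to `v zero` becomes a nontrivial relation once `v zero` itself gets
        -- the coefficient -1.
        ind ( (λ { zero → R.- R.1# ; (suc i) → k i }) , (zero , -1≉0)
            , ≈ᴹ-trans (+ᴹ-cong (-1*x≈-x (v zero)) (≈ᴹ-sym e)) (-ᴹ‿inverseˡ (v zero)))) ,
      independent⇒indep (v ∘ suc)
        λ (k , (i , ki≉0) , e) → ind
          ( (λ { zero → R.0# ; (suc i) → k i }) , (suc i , ki≉0)
          , ≈ᴹ-trans (+ᴹ-congʳ (*ₗ-zeroˡ (v zero))) (≈ᴹ-trans (+ᴹ-identityˡ _) e))

    span-cancel : ∀ {ws k v y} → ¬ k R.≈ R.0# → Span ws (k *ₗ v +ᴹ y) → Span ws y → Span ws v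
    span-cancel {k = k} {v} {y} k≉0 s y∈ =
      let (k⁻¹ , k⁻¹k≈1 , _) = inverse k k≉0 in
      Sp.resp-≈
        (≈ᴹ-trans (≈ᴹ-sym (*ₗ-assoc k⁻¹ k v)) (≈ᴹ-trans (*ₗ-congʳ k⁻¹k≈1) (*ₗ-identityˡ v)))
        (Sp.*-mem k⁻¹ (Sp.resp-≈ (+-move ≈ᴹ-refl) (Sp.+-mem s (-‿mem (span-isSubspace _) y∈))))

    -- A nonzero first coefficient lets one solve for `v zero` in terms of the rest; a zero one
    -- leaves a shorter nontrivial relation.
    indep⇒independent : ∀ {n} (v : Vector Carrierᴹ n) → Indep (tabulate v) → LinearlyIndependent v
    indep⇒independent {suc n} v (v∉ , v-ind) (k , k≢0 , e) = ¬¬-excluded-middle λ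
      { (no k₀≉0) →
          v∉ (span-cancel k₀≉0 (Sp.resp-≈ (≈ᴹ-sym e) Sp.0-mem) (combination⇒span (k ∘ suc) (v ∘ suc)))
      ; (yes k₀≈0) → indep⇒independent (v ∘ suc) v-ind
          ( k ∘ suc , tail-nonzero k₀≈0 k≢0
          , ≈ᴹ-trans (≈ᴹ-sym (≈ᴹ-trans (+ᴹ-congʳ (≈ᴹ-trans (*ₗ-congʳ k₀≈0) (*ₗ-zeroˡ _))) (+ᴹ-identityˡ _))) e)
      }
      where
      tail-nonzero : k zero R.≈ R.0# → ∃[ i ] ¬ k i R.≈ R.0# → ∃[ i ] ¬ k (suc i) R.≈ R.0#
      tail-nonzero k₀≈0 (zero  , k₀≉0) = ⊥-elim (k₀≉0 k₀≈0)
      tail-nonzero k₀≈0 (suc i , kᵢ≉0) = i , kᵢ≉0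

    -- In the expansion of `x`, the first member of `cs` with nonzero coefficient can be traded for
    -- `x`. If all these coefficients vanished, `x` would lie in `Span ys`.
    exchange : ∀ cs ys {x} → Span (cs ++ ys) x → ¬ Span ys x →
               ¬ ¬ (∃[ cs′ ] suc (length cs′) ≡ length cs × All (Span (cs′ ++ x ∷ ys)) (cs ++ ys))
    exchange []       ys x∈ x∉ done = x∉ x∈
    exchange (c ∷ cs) ys {x} (cons {y = y} k s e) x∉ done = ¬¬-excluded-middle λ
      { (yes k≈0) →
          let e′ = ≈ᴹ-trans e (≈ᴹ-trans (+ᴹ-congʳ (≈ᴹ-trans (*ₗ-congʳ k≈0) (*ₗ-zeroˡ c))) (+ᴹ-identityˡ y))
          in exchange cs ys (Sp.resp-≈ (≈ᴹ-sym e′) s) x∉ λ (cs′ , eq , gens) →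
             done (c ∷ cs′ , cong suc eq , span-head ∷ All.map span-weaken gens)
      ; (no k≉0) → done (cs , refl ,
          span-cancel k≉0 (Sp.resp-≈ e (∈⇒span (∈-insert cs))) (span-mono incl s) ∷
          All.tabulate (∈⇒span ∘ incl))
      }
      where
      incl : cs ++ ys ⊆ cs ++ x ∷ ys
      incl = ++⁺ʳ cs (xs⊆x∷xs ys x)

    -- The members of `xs` are traded in from the last to the first; `Indep` says of each that it
    -- avoids the span of those after it, which is what `exchange` asks for.
    steinitz : ∀ cs xs → Indep xs → All (λ x → ¬ ¬ Span cs x) xs →
               ¬ ¬ (∃[ cs′ ] length cs′ + length xs ≡ length cs × All (Span (cs′ ++ xs)) cs)
    steinitz cs []       _ _ done = done (cs , ℕ.+-identityʳ _ , All.tabulate (∈⇒span ∘ ∈-++⁺ˡ))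
    steinitz cs (x ∷ xs) (x∉ , xs-ind) (x∈ ∷ xs⊆) done =
      x∈ λ x∈cs →
      steinitz cs xs xs-ind xs⊆ λ (cs′ , eq , gens) →
      exchange cs′ xs (span-⊆ gens x∈cs) x∉ λ (cs″ , eq′ , gens′) →
      done ( cs″
           , ≡.trans (ℕ.+-suc (length cs″) (length xs)) (≡.trans (cong (_+ length xs) eq′) eq)
           , All.map (span-⊆ gens′) gens)

    -- Comparison of natural numbers is decidable, so the ¬ ¬ of `steinitz` disappears here.
    indep-length : ∀ {cs} xs → Indep xs → All (λ x → ¬ ¬ Span cs x) xs → length xs ≤ length cs
    indep-length {cs} xs xs-ind xs⊆ = decidable-stable (length xs ℕ.≤? length cs) λ ¬≤ →
      steinitz cs xs xs-ind xs⊆ λ (cs′ , eq , _) →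
      ¬≤ (ℕ.≤-trans (ℕ.m≤n+m _ (length cs′)) (ℕ.≤-reflexive eq))

    -- By the count in `steinitz`, no member of `cs` is left over after the exchange, so `xs` spans
    -- alone.
    indep-spans : ∀ {cs} xs → Indep xs → All (Span cs) xs → length cs ≤ length xs →
                  ∀ {x} → Span cs x → ¬ ¬ Span xs x
    indep-spans {cs} xs xs-ind xs⊆ cs≤xs x∈cs done =
      steinitz cs xs xs-ind (All.map (λ s ¬s → ¬s s) xs⊆) λ
      { ([]     , _  , gens) → done (span-⊆ gens x∈cs)
      ; (_ ∷ cs′ , eq , _)   →
          ℕ.<⇒≱ (ℕ.≤-trans (s≤s (ℕ.m≤n+m (length xs) (length cs′))) (ℕ.≤-reflexive eq)) cs≤xs
      }

    indep-escapes : ∀ {cs} xs → Indep xs → length cs < length xs →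
                    ¬ ¬ (∃[ x ] x ∈ₗ xs × ¬ Span cs x)
    indep-escapes xs xs-ind cs<xs done = ℕ.<⇒≱ cs<xs
      (indep-length xs xs-ind (All.tabulate λ x∈xs x∉cs → done (_ , x∈xs , x∉cs)))

-- Multiplications in L as linear maps.

module Growth {K : CommutativeRing a b} (K-field : IsField K)
              {L : Ring c ℓ} (L-div : IsDivisionRing L)
              (E : CentralEmbedding K L) where
  private
    module K = CommutativeRing K
    module K-field = IsDivisionRing K-field
  open Ring L renaming (refl to ≈-refl; sym to ≈-sym; trans to ≈-trans; _+_ to _+ᴸ_)
  open CentralEmbedding E
  open IsRingMonomorphism isRingMonomorphism using (⟦⟧-cong; *-homo; 0#-homo; 1#-homo)
  open IsDivisionRing L-div
  open Exp semiring using (_^_)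
  open Span asModule
  open SetoidReasoning setoid

  -- Compatibility with scalars is where K being central enters; `*-linearˡ` only needs
  -- associativity.
  *-linearʳ : ∀ x → IsLinear (x *_)
  *-linearʳ x = record
    { f-cong = *-congˡ
    ; +-homo = distribˡ x
    ; *-homo = λ k y → begin
        x * (ι k * y)  ≈⟨ *-assoc x (ι k) y ⟨
        (x * ι k) * y  ≈⟨ *-congʳ (central k x) ⟨
        (ι k * x) * y  ≈⟨ *-assoc (ι k) x y ⟩
        ι k * (x * y)  ∎
    }

  *-linearˡ : ∀ x → IsLinear (_* x)
  *-linearˡ x = record
    { f-cong = *-congʳ
    ; +-homo = distribʳ x
    ; *-homo = λ k y → *-assoc (ι k) y x
    }

  module _ {x x⁻¹} (x⁻¹x≈1 : x⁻¹ * x ≈ 1#) where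

    inverse-cancelˡ : ∀ y → x⁻¹ * (x * y) ≈ y
    inverse-cancelˡ y = begin
      x⁻¹ * (x * y)  ≈⟨ *-assoc x⁻¹ x y ⟨
      (x⁻¹ * x) * y  ≈⟨ *-congʳ x⁻¹x≈1 ⟩
      1# * y         ≈⟨ *-identityˡ y ⟩
      y              ∎

    inverse-cancelʳ : ∀ y → (y * x⁻¹) * x ≈ y
    inverse-cancelʳ y = begin
      (y * x⁻¹) * x  ≈⟨ *-assoc y x⁻¹ x ⟩
      y * (x⁻¹ * x)  ≈⟨ *-congˡ x⁻¹x≈1 ⟩
      y * 1#         ≈⟨ *-identityʳ y ⟩
      y              ∎

    *-injectiveˡ : ∀ {y z} → x * y ≈ x * z → y ≈ z
    *-injectiveˡ e =
      ≈-trans (≈-sym (inverse-cancelˡ _)) (≈-trans (*-congˡ e) (inverse-cancelˡ _))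

    *-injectiveʳ : ∀ {y z} → y * x⁻¹ ≈ z * x⁻¹ → y ≈ z
    *-injectiveʳ e =
      ≈-trans (≈-sym (inverse-cancelʳ _)) (≈-trans (*-congʳ e) (inverse-cancelʳ _))

  -- Pairs of spaces with products in a fixed space.

  Products : List Carrier → List Carrier → List Carrier → Set (a ⊔ c ⊔ ℓ)
  Products cs as bs = ∀ {u v} → Span as u → Span bs v → Span cs (u * v)

  -- The state of the descent: bases of two nonzero spaces that change, while `Span cs`, in the end
  -- ⟨AB⟩, stays fixed.
  record Pair (cs as bs : List Carrier) : Set (a ⊔ c ⊔ ℓ) where
    field
      indepˡ    : Indep as
      indepʳ    : Indep bs
      nonemptyˡ : 1 ≤ length as
      nonemptyʳ : 1 ≤ length bs
      products  : Products cs as bs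

  head : ∀ vs → Indep vs → 1 ≤ length vs → ∃[ v ] Span vs v × ¬ v ≈ 0#
  head (v ∷ vs) (v∉ , _) _ = v , span-head , ¬span⇒≉0 v∉

  indep-*ʳ : ∀ {x} → ¬ x ≈ 0# → ∀ vs → Indep vs → Indep (map (_* x) vs)
  indep-*ʳ {x} x≉0 = IsLinear.indep-map (*-linearˡ x) (*-injectiveʳ (proj₂ (proj₂ (inverse x x≉0))))

  indep-*ˡ : ∀ {x} → ¬ x ≈ 0# → ∀ vs → Indep vs → Indep (map (x *_) vs)
  indep-*ˡ {x} x≉0 = IsLinear.indep-map (*-linearʳ x) (*-injectiveˡ (proj₁ (proj₂ (inverse x x≉0))))

  products-*ʳ : ∀ {cs as bs v} → Products cs as bs → Span bs v → All (Span cs) (map (_* v) as)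
  products-*ʳ products v∈ = All.map⁺ (All.tabulate λ u∈ → products (∈⇒span u∈) v∈)

  products-*ˡ : ∀ {cs as bs u} → Products cs as bs → Span as u → All (Span cs) (map (u *_) bs)
  products-*ˡ products u∈ = All.map⁺ (All.tabulate λ v∈ → products u∈ (∈⇒span v∈))

  indep-size : ∀ {cs} xs → Indep xs → All (Span cs) xs → length xs ≤ length cs
  indep-size xs xs-ind xs⊆ = indep-length K-field xs xs-ind (All.map (λ s ¬s → ¬s s) xs⊆)

  -- For nonzero u and v from the two spaces, multiplying by v on the right or by u on the left is
  -- injective and leads into `Span cs`.
  size≤ : ∀ {cs as bs} → Pair cs as bs → length as ≤ length cs × length bs ≤ length cs
  size≤ {cs} {as} {bs} P =
    let (u , u∈ , u≉0) = head as indepˡ nonemptyˡ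
        (v , v∈ , v≉0) = head bs indepʳ nonemptyʳ
    in subst (_≤ length cs) (length-map _ as)
         (indep-size _ (indep-*ʳ v≉0 as indepˡ) (products-*ʳ products v∈)) ,
       subst (_≤ length cs) (length-map _ bs)
         (indep-size _ (indep-*ˡ u≉0 bs indepʳ) (products-*ˡ products u∈))
    where open Pair P

  -- A v and u B lie in ⟨AB⟩, which is so small that they meet in dimension at least 2.
  coincidence : ∀ {cs as bs} → Pair cs as bs → suc (length cs) < length as + length bs →
                ∀ {u v} → Span as u → ¬ u ≈ 0# → Span bs v → ¬ v ≈ 0# →
                ¬ ¬ (∃[ u′ ] ∃[ v′ ] Span as u′ × Span bs v′ ×
                      u′ * v ≈ u * v′ × ¬ Span [ u * v ] (u′ * v))
  coincidence {cs} {as} {bs} P small {u} {v} u∈ u≉0 v∈ v≉0 done =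
    sum-∩ (span-isSubspace (map (_* v) as)) (All.tabulate ∈⇒span) (indep-*ʳ v≉0 as indepˡ)
          (map (u *_) bs) (indep-*ˡ u≉0 bs indepʳ)
      λ (ys , zs , ys-ind , ys⊆ , zs-ind , zs⊆A , zs⊆B , _ , eq) →
    let ys≤cs : length ys ≤ length cs
        ys≤cs = indep-size ys ys-ind (All.map inside ys⊆)
        eq′ : length ys + length zs ≡ length as + length bs
        eq′ = ≡.trans eq (≡.cong₂ _+_ (length-map _ as) (length-map _ bs))
        1<zs : 1 < length zs
        1<zs = ℕ.+-cancelˡ-< (length cs) 1 (length zs)
          (ℕ.≤-trans (s≤s (ℕ.≤-reflexive (ℕ.+-comm (length cs) 1)))
            (ℕ.≤-trans small (ℕ.≤-trans (ℕ.≤-reflexive (≡.sym eq′)) (ℕ.+-monoˡ-≤ (length zs) ys≤cs))))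
    -- The implicit list is `[ u * v ]`: one vector cannot span two independent ones, so some common
    -- vector lies outside K u v.
    in indep-escapes K-field zs zs-ind 1<zs λ (z , z∈zs , z∉) →
    let (u′ , u′∈ , z≈u′v) = IsLinear.span-map⁻ (*-linearˡ v) as (All.lookup zs⊆A z∈zs)
        (v′ , v′∈ , z≈uv′) = IsLinear.span-map⁻ (*-linearʳ u) bs (All.lookup zs⊆B z∈zs)
    in done (u′ , v′ , u′∈ , v′∈ , ≈-trans (≈-sym z≈u′v) z≈uv′ , z∉ ∘ Sp.resp-≈ (≈-sym z≈u′v))
    where
    open Pair P
    inside : ∀ {x} → (Span (map (_* v) as) ⊞ Span (map (u *_) bs)) x → Span cs x
    inside (s , t , s∈ , t∈ , e) = Sp.resp-≈ (≈-sym e)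
      (Sp.+-mem (span-⊆ (products-*ʳ products v∈) s∈) (span-⊆ (products-*ˡ products u∈) t∈))

  -- Powers of a transcendental element.

  *-^-closed : ∀ {V : Pred Carrier p} → IsSubspace V → ∀ {y} → (∀ {u} → V u → V (u * y)) →
               ∀ i {u} → V u → V (u * (y ^ i))
  *-^-closed V-sub closed zero    {u} u∈ = IsSubspace.resp-≈ V-sub (≈-sym (*-identityʳ u)) u∈
  *-^-closed V-sub closed (suc i) {u} u∈ =
    IsSubspace.resp-≈ V-sub (*-assoc u _ _) (*-^-closed V-sub closed i (closed u∈))

  -- Stability would put all u yⁱ with i ≤ |as| into the space, one vector more than `as` allows.
  -- They are independent, because a relation between `powers` is a polynomial vanishing at y.
  transcendental-unstable : ∀ {as u y} → Span as u → ¬ u ≈ 0# → y ∈ Transcendental →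
                            ¬ (∀ {u} → Span as u → ¬ ¬ Span as (u * y))
  transcendental-unstable {as} {u} {y} u∈ u≉0 y-tr stable =
    ℕ.1+n≰n (subst (_≤ length as) (≡.trans (length-map _ (tabulate powers)) (length-tabulate powers))
      (indep-length K-field (map (u *_) (tabulate powers))
        (indep-*ˡ u≉0 _ (independent⇒indep K-field powers (y-tr ∘ (_ ,_))))
        (All.map⁺ (All.tabulate⁺ λ i →
          *-^-closed (¬¬-isSubspace (span-isSubspace as)) (λ ¬¬s ¬t → ¬¬s λ s → stable s ¬t)
            (toℕ i) λ ¬s → ¬s u∈))))
    where
    powers : Vector Carrier (suc (length as))
    powers i = y ^ toℕ i

  Improves : (as bs as′ bs′ : List Carrier) → Set
  Improves as bs as′ bs′ =
    length as + length bs < length as′ + length bs′ ⊎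
    (length as + length bs ≤ length as′ + length bs′ × length as′ < length as)

  -- The transformation of a pair and the descent.

  module _ (trans-outside : ∀ x → ¬ (x ∈ Image) → x ∈ Transcendental) where

    -- The elements u′ = u x and v = y v′ show that A ∩ A x and B ∩ y B are nonzero, as both new
    -- pairs require.
    transform : ∀ {cs as bs} → Pair cs as bs → ∀ {x y u u′ v v′} →
                x * y ≈ 1# → ¬ (y ∈ Image) →
                Span as u → ¬ u ≈ 0# → Span as u′ → ¬ u′ ≈ 0# → u′ ≈ u * x →
                Span bs v → ¬ v ≈ 0# → Span bs v′ → v ≈ y * v′ →
                ¬ ¬ (∃[ as′ ] ∃[ bs′ ] Pair cs as′ bs′ × Improves as bs as′ bs′)
    transform {cs} {as} {bs} P {x} {y} {u} {u′} {v} {v′} xy≈1 y∉K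
              u∈ u≉0 u′∈ u′≉0 u′≈ux v∈ v≉0 v′∈ v≈yv′ done =
      sum-∩-nonzero (span-isSubspace as) (All.tabulate ∈⇒span) indepˡ
        (map (_* x) as) (IsLinear.indep-map (*-linearˡ x) (*-injectiveʳ xy≈1) as indepˡ)
        u′∈ (Sp.resp-≈ (≈-sym u′≈ux) (IsLinear.span-map⁺ (*-linearˡ x) u∈)) u′≉0
        λ (A+ , A∩ , A+-ind , A+⊆ , A∩-ind , A∩⊆A , A∩⊆Ax , A≤A+ , 1≤A∩ , A-dim) →
      sum-∩-nonzero (span-isSubspace bs) (All.tabulate ∈⇒span) indepʳ
        (map (y *_) bs) (IsLinear.indep-map (*-linearʳ y) (*-injectiveˡ xy≈1) bs indepʳ)
        v∈ (Sp.resp-≈ (≈-sym v≈yv′) (IsLinear.span-map⁺ (*-linearʳ y) v′∈)) v≉0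
        λ (B+ , B∩ , B+-ind , B+⊆ , B∩-ind , B∩⊆B , B∩⊆yB , B≤B+ , 1≤B∩ , B-dim) →
      let A∩<A : length A∩ < length as
          -- If A ∩ A x had full dimension, then A would lie in A x; multiplying by y = x⁻¹ would
          -- map A into itself.
          A∩<A = ℕ.≰⇒> λ A≤A∩ → transcendental-unstable u∈ u≉0 (trans-outside y y∉K)
            λ s ¬t → indep-spans K-field A∩ A∩-ind A∩⊆A A≤A∩ s (¬t ∘ divide A∩⊆Ax)
          pair₁ : Pair cs A∩ B+
          pair₁ = record
            { indepˡ = A∩-ind ; indepʳ = B+-ind
            ; nonemptyˡ = 1≤A∩ ; nonemptyʳ = ℕ.≤-trans nonemptyʳ B≤B+
            ; products = λ s t → products-∩+ (span-⊆ A∩⊆A s) (span-⊆ A∩⊆Ax s)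
                (span-least (⊞-isSubspace (span-isSubspace _) (span-isSubspace _)) B+⊆ t) }
          pair₂ : Pair cs A+ B∩
          pair₂ = record
            { indepˡ = A+-ind ; indepʳ = B∩-ind
            ; nonemptyˡ = ℕ.≤-trans nonemptyˡ A≤A+ ; nonemptyʳ = 1≤B∩
            ; products = λ s t → products-+∩
                (span-least (⊞-isSubspace (span-isSubspace _) (span-isSubspace _)) A+⊆ s)
                (span-⊆ B∩⊆B t) (span-⊆ B∩⊆yB t) }
      in done (choose A∩ B+ A+ B∩ A∩<A pair₁ pair₂
           (subst (_≤ length A+ + length A∩) (cong (length as +_) (length-map _ as)) A-dim)
           (subst (_≤ length B+ + length B∩) (cong (length bs +_) (length-map _ bs)) B-dim))
      where
      open Pair P

      divide : ∀ {A∩} → All (Span (map (_* x) as)) A∩ → ∀ {w} → Span A∩ w → Span as (w * y)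
      divide A∩⊆Ax s =
        let (w′ , w′∈ , e) = IsLinear.span-map⁻ (*-linearˡ x) as (span-⊆ A∩⊆Ax s)
        in Sp.resp-≈ (≈-sym (≈-trans (*-congʳ e) (inverse-cancelʳ xy≈1 w′))) w′∈

      middle-cancel : ∀ s t → (s * x) * (y * t) ≈ s * t
      middle-cancel s t = ≈-trans (≈-sym (*-assoc (s * x) y t)) (*-congʳ (inverse-cancelʳ xy≈1 s))

      -- The factors x and y cancel in the middle, so A x times y B gives nothing beyond AB.
      products-xy : ∀ {s t} → Span (map (_* x) as) s → Span (map (y *_) bs) t → Span cs (s * t)
      products-xy s∈ t∈ =
        let (s′ , s′∈ , e)  = IsLinear.span-map⁻ (*-linearˡ x) as s∈
            (t′ , t′∈ , e′) = IsLinear.span-map⁻ (*-linearʳ y) bs t∈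
        in Sp.resp-≈ (≈-sym (≈-trans (*-cong e e′) (middle-cancel s′ t′))) (products s′∈ t′∈)

      -- The factor s is used as an element of A against the part of t in B, and as an element of A
      -- x against the part in y B. `products-+∩` is the mirror image.
      products-∩+ : ∀ {s t} → Span as s → Span (map (_* x) as) s →
                    (Span bs ⊞ Span (map (y *_) bs)) t → Span cs (s * t)
      products-∩+ s∈ s∈x (t₁ , t₂ , t₁∈ , t₂∈ , e) =
        Sp.resp-≈ (≈-sym (≈-trans (*-congˡ e) (distribˡ _ t₁ t₂)))
          (Sp.+-mem (products s∈ t₁∈) (products-xy s∈x t₂∈))

      products-+∩ : ∀ {s t} → (Span as ⊞ Span (map (_* x) as)) s →
                    Span bs t → Span (map (y *_) bs) t → Span cs (s * t)
      products-+∩ (s₁ , s₂ , s₁∈ , s₂∈ , e) t∈ t∈y =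
        Sp.resp-≈ (≈-sym (≈-trans (*-congʳ e) (distribʳ _ s₁ s₂)))
          (Sp.+-mem (products s₁∈ t∈) (products-xy s₂∈ t∈y))

      -- The four dimensions total at least twice |as| + |bs|. So if the first pair has a smaller
      -- sum than before, the second has a larger one; otherwise the first pair serves, its left
      -- space being smaller.
      choose : ∀ A∩ B+ A+ B∩ → length A∩ < length as → Pair cs A∩ B+ → Pair cs A+ B∩ →
               length as + length as ≤ length A+ + length A∩ →
               length bs + length bs ≤ length B+ + length B∩ →
               ∃[ as′ ] ∃[ bs′ ] Pair cs as′ bs′ × Improves as bs as′ bs′
      choose A∩ B+ A+ B∩ A∩<A pair₁ pair₂ A-dim B-dim
        with length as + length bs ℕ.≤? length A∩ + length B+
      ... | yes ≤₁ = A∩ , B+ , pair₁ , inj₂ (≤₁ , A∩<A)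
      ... | no  ≰₁ with length as + length bs ℕ.<? length A+ + length B∩
      ...   | yes <₂ = A+ , B∩ , pair₂ , inj₁ <₂
      ...   | no  ≮₂ = ⊥-elim (ℕ.<⇒≱ (ℕ.+-mono-<-≤ (ℕ.≰⇒> ≰₁) (ℕ.≮⇒≥ ≮₂))
              (ℕ.≤-trans (ℕ.≤-reflexive (interchange (length as) (length bs) (length as) (length bs)))
                (ℕ.≤-trans (ℕ.+-mono-≤ A-dim B-dim)
                  (ℕ.≤-reflexive (swap (length A+) (length A∩) (length B+) (length B∩))))))
        where
        open CommutativeSemigroupProperties ℕ.+-commutativeSemigroup using (interchange)
        swap : ∀ i j k l → (i + j) + (k + l) ≡ (j + k) + (i + l)
        swap i j k l = ≡.trans (cong (_+ (k + l)) (ℕ.+-comm i j)) (interchange j i k l)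

    improve : ∀ {cs as bs} → Pair cs as bs → suc (length cs) < length as + length bs →
              ¬ ¬ (∃[ as′ ] ∃[ bs′ ] Pair cs as′ bs′ × Improves as bs as′ bs′)
    improve {cs} {as} {bs} P small done =
      let (u , u∈ , u≉0) = head as indepˡ nonemptyˡ
          (v , v∈ , v≉0) = head bs indepʳ nonemptyʳ
      in coincidence P small u∈ u≉0 v∈ v≉0 λ (u′ , v′ , u′∈ , v′∈ , u′v≈uv′ , u′v∉) →
      let u′≉0 : ¬ u′ ≈ 0#
          u′≉0 u′≈0 = ¬span⇒≉0 u′v∉ (≈-trans (*-congʳ u′≈0) (zeroˡ v))
          (u⁻¹ , u⁻¹u≈1 , uu⁻¹≈1)       = inverse u u≉0
          (u′⁻¹ , u′⁻¹u′≈1 , u′u′⁻¹≈1) = inverse u′ u′≉0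
          x = u⁻¹ * u′
          y = u′⁻¹ * u
          u′≈ux : u′ ≈ u * x
          u′≈ux = ≈-sym (inverse-cancelˡ uu⁻¹≈1 u′)
          xy≈1 : x * y ≈ 1#
          xy≈1 = begin
            (u⁻¹ * u′) * (u′⁻¹ * u)  ≈⟨ *-assoc u⁻¹ u′ _ ⟩
            u⁻¹ * (u′ * (u′⁻¹ * u))  ≈⟨ *-congˡ (inverse-cancelˡ u′u′⁻¹≈1 u) ⟩
            u⁻¹ * u                  ≈⟨ u⁻¹u≈1 ⟩
            1#                       ∎
          yx≈1 : y * x ≈ 1#
          yx≈1 = begin
            (u′⁻¹ * u) * (u⁻¹ * u′)  ≈⟨ *-assoc u′⁻¹ u _ ⟩
            u′⁻¹ * (u * (u⁻¹ * u′))  ≈⟨ *-congˡ (inverse-cancelˡ uu⁻¹≈1 u′) ⟩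
            u′⁻¹ * u′                ≈⟨ u′⁻¹u′≈1 ⟩
            1#                       ∎
          v≈yv′ : v ≈ y * v′
          v≈yv′ = begin
            v                   ≈⟨ inverse-cancelˡ u′⁻¹u′≈1 v ⟨
            u′⁻¹ * (u′ * v)     ≈⟨ *-congˡ u′v≈uv′ ⟩
            u′⁻¹ * (u * v′)     ≈⟨ *-assoc u′⁻¹ u v′ ⟨
            y * v′              ∎
      in transform P xy≈1 (scalar-absurd u′v∉ u′≈ux yx≈1)
           u∈ u≉0 u′∈ u′≉0 u′≈ux v∈ v≉0 v′∈ v≈yv′ done
      where
      open Pair P
      -- If y came from a scalar k, then k would be nonzero because y x = 1, and x would be the
      -- scalar k⁻¹. Being central, it could be pulled out of u x v, placing u′ v in K u v.
      scalar-absurd : ∀ {u u′ v x y} → ¬ Span [ u * v ] (u′ * v) → u′ ≈ u * x → y * x ≈ 1# →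
                      ¬ (y ∈ Image)
      scalar-absurd {u} {u′} {v} {x} {y} u′v∉ u′≈ux yx≈1 (k , ιk≈y) =
        let (l , lk≈1 , _) = K-field.inverse k k≉0
            x≈ιl : x ≈ ι l
            x≈ιl = begin
              x                ≈⟨ *-identityˡ x ⟨
              1# * x           ≈⟨ *-congʳ (≈-trans (≈-sym (*-homo l k)) (≈-trans (⟦⟧-cong lk≈1) 1#-homo)) ⟨
              (ι l * ι k) * x  ≈⟨ *-assoc _ _ x ⟩
              ι l * (ι k * x)  ≈⟨ *-congˡ (≈-trans (*-congʳ ιk≈y) yx≈1) ⟩
              ι l * 1#         ≈⟨ *-identityʳ _ ⟩
              ι l              ∎
        in u′v∉ (Sp.resp-≈ (begin
             ι l * (u * v)    ≈⟨ *-assoc (ι l) u v ⟨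
             (ι l * u) * v    ≈⟨ *-congʳ (central l u) ⟩
             (u * ι l) * v    ≈⟨ *-congʳ (*-congˡ x≈ιl) ⟨
             (u * x) * v      ≈⟨ *-congʳ u′≈ux ⟨
             u′ * v           ∎)
             (Sp.*-mem l span-head))
        where
        k≉0 : ¬ k K.≈ K.0#
        k≉0 k≈0 = 1≉0 (begin
          1#          ≈⟨ yx≈1 ⟨
          y * x       ≈⟨ *-congʳ (≈-trans (≈-sym ιk≈y) (≈-trans (⟦⟧-cong k≈0) 0#-homo)) ⟩
          0# * x      ≈⟨ zeroˡ x ⟩
          0#          ∎)

    -- A lexicographic induction: i bounds how far |as| + |bs| can still grow, as
    -- it is at most 2 |cs|, and j bounds |as|.
    NoSmallPair : ℕ → ℕ → Set (a ⊔ c ⊔ ℓ)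
    NoSmallPair i j = ∀ {cs as bs} → Pair cs as bs → suc (length cs) < length as + length bs →
                      length cs + length cs < i + (length as + length bs) → length as < j → ⊥

    -- A growing sum uses up one unit of i, after which j is reset to fit the new left space; a
    -- shrinking left space keeps i and lowers j.
    no-small-pair-step : ∀ i j → (∀ j′ → NoSmallPair i j′) → NoSmallPair (suc i) j →
                         NoSmallPair (suc i) (suc j)
    no-small-pair-step i j ih-grow ih-shrink P small bound as<1+j = improve P small λ
      { (as′ , _ , P′ , inj₁ grows) →
          ih-grow (suc (length as′)) P′ (ℕ.<-trans small grows)
            (ℕ.<-≤-trans bound (ℕ.≤-trans (ℕ.≤-reflexive (≡.sym (ℕ.+-suc i _))) (ℕ.+-monoʳ-≤ i grows)))
            ℕ.≤-refl
      ; (_ , _ , P′ , inj₂ (≤sum , shrinks)) →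
          ih-shrink P′ (ℕ.<-≤-trans small ≤sum)
            (ℕ.<-≤-trans bound (ℕ.+-monoʳ-≤ (suc i) ≤sum))
            (ℕ.<-≤-trans shrinks (ℕ.≤-pred as<1+j))
      }

    no-small-pair : ∀ i j → NoSmallPair i j
    no-small-pair zero    j       P _ bound _ =
      -- With i = 0 the bound says that |as| + |bs| exceeds 2 |cs|.
      ℕ.<⇒≱ bound (ℕ.+-mono-≤ (proj₁ (size≤ P)) (proj₂ (size≤ P)))
    no-small-pair (suc i) zero    _ _ _     ()
    no-small-pair (suc i) (suc j) =
      no-small-pair-step i j (no-small-pair i) (no-small-pair (suc i) j)

    pair-size : ∀ {cs as bs} → Pair cs as bs → length as + length bs ≤ suc (length cs)
    pair-size {cs} {as} P = ℕ.≮⇒≥ λ small →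
      -- Starting with i above 2 |cs| makes the growth bound hold trivially.
      no-small-pair (suc (length cs + length cs)) (suc (length as)) P small
        (s≤s (ℕ.m≤m+n _ _)) ℕ.≤-refl

  -- From bases of A, B and ⟨AB⟩ to pairs.

  nonzero⇒1≤ : ∀ {V : Pred Carrier p} {n} {e : Vector Carrier n} → Nonzero V → IsBasis V e → 1 ≤ n
  nonzero⇒1≤ {n = zero}  (x , x∈ , x≉0) e-basis = ⊥-elim (x≉0 (proj₂ (IsBasis.spanning e-basis x∈)))
  nonzero⇒1≤ {n = suc n} _              _       = s≤s z≤n

  basis⇒span : ∀ {V : Pred Carrier p} {n} {e : Vector Carrier n} → IsBasis V e →
               ∀ {x} → V x → Span (tabulate e) x
  basis⇒span {e = e} e-basis x∈ = let (k , x≈) = IsBasis.spanning e-basis x∈ in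
    Sp.resp-≈ (≈-sym x≈) (combination⇒span k e)

  span⇒basis : ∀ {V : Pred Carrier p} {n} {e : Vector Carrier n} → IsSubspace V → IsBasis V e →
               ∀ {x} → Span (tabulate e) x → V x
  span⇒basis V-sub e-basis = span-least V-sub (All.tabulate⁺ (IsBasis.member e-basis))

  list-basis : ∀ {V : Pred Carrier p} es → Indep es → All V es → (∀ {x} → V x → Span es x) →
               IsBasis V (lookup es)
  list-basis {V = V} es es-ind es⊆V V⊆es = record
    { member      = λ i → All.lookup es⊆V (∈-lookup i)
    ; independent = indep⇒independent K-field (lookup es)
                      (subst Indep (≡.sym (tabulate-lookup es)) es-ind)
    ; spanning    = λ x∈ → span⇒combination (lookup es)
                      (subst (λ vs → Span vs _) (≡.sym (tabulate-lookup es)) (V⊆es x∈))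
    }

  module _ {A : Pred Carrier p} {B : Pred Carrier q}
           {m n} {e : Vector Carrier m} {f : Vector Carrier n}
           (e-basis : IsBasis A e) (f-basis : IsBasis B f) where

    -- The finitely many products of basis vectors span ⟨AB⟩; thinning them out to a basis needs
    -- case distinctions on membership in spans, hence the ¬ ¬.
    product-finite : ¬ ¬ FiniteDimensional ⟨ A · B ⟩
    product-finite done = extract-basis gs λ (es , es-ind , es⊆gs , gs⊆es) →
      done (length es , lookup es , list-basis es es-ind
        (All.tabulate (gs⊆AB ∘ es⊆gs))
        λ (n , k , v , v∈ , x≈) → Sp.resp-≈ (≈-sym x≈)
          (combination-mem (span-isSubspace es) k v (span-⊆ gs⊆es ∘ AB⊆gs ∘ v∈)))
      where
      gs = cartesianProductWith _*_ (tabulate e) (tabulate f)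

      gs⊆AB : ∀ {g} → g ∈ₗ gs → ⟨ A · B ⟩ g
      gs⊆AB g∈ with ∈-cartesianProductWith⁻ _*_ (tabulate e) (tabulate f) g∈
      ... | (u , v , u∈ , v∈ , refl) with ∈-tabulate⁻ u∈ | ∈-tabulate⁻ v∈
      ...   | (i , refl) | (j , refl) =
        1 , (λ _ → K.1#) , (λ _ → e i * f j) ,
        (λ _ → e i , f j , IsBasis.member e-basis i , IsBasis.member f-basis j , ≈-refl) ,
        ≈-sym (≈-trans (+-identityʳ _) (≈-trans (*-congʳ 1#-homo) (*-identityˡ _)))

      -- Bilinearity, one variable at a time: the preimage of `Span gs` under a multiplication is a
      -- subspace, so checking basis vectors is enough.
      AB⊆gs : ∀ {x} → (A · B) x → Span gs x
      AB⊆gs (y , z , y∈ , z∈ , x≈yz) = Sp.resp-≈ (≈-sym x≈yz)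
        (span-least (IsLinear.preimage-isSubspace (*-linearˡ z) (span-isSubspace gs))
          (All.tabulate λ {u} u∈ →
            span-least (IsLinear.preimage-isSubspace (*-linearʳ u) (span-isSubspace gs))
              (All.tabulate λ v∈ → ∈⇒span (∈-cartesianProductWith⁺ _*_ u∈ v∈))
              (basis⇒span f-basis z∈))
          (basis⇒span e-basis y∈))

    bases-pair : IsSubspace A → IsSubspace B → Nonzero A → Nonzero B →
                 ∀ {d} {h : Vector Carrier d} → IsBasis ⟨ A · B ⟩ h →
                 Pair (tabulate h) (tabulate e) (tabulate f)
    bases-pair A-sub B-sub A≠0 B≠0 {h = h} h-basis = record
      { indepˡ    = independent⇒indep K-field e (IsBasis.independent e-basis)
      ; indepʳ    = independent⇒indep K-field f (IsBasis.independent f-basis)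
      ; nonemptyˡ = subst (1 ≤_) (≡.sym (length-tabulate e)) (nonzero⇒1≤ A≠0 e-basis)
      ; nonemptyʳ = subst (1 ≤_) (≡.sym (length-tabulate f)) (nonzero⇒1≤ B≠0 f-basis)
      ; products  = λ {u} {v} u∈ v∈ → basis⇒span h-basis
          ( 1 , (λ _ → K.1#) , (λ _ → u * v)
          , (λ _ → u , v , span⇒basis A-sub e-basis u∈ , span⇒basis B-sub f-basis v∈ , ≈-refl)
          , ≈-sym (≈-trans (+-identityʳ _) (≈-trans (*-congʳ 1#-homo) (*-identityˡ _))) )
      }

mainTheorem7 : {a b c ℓ p q : Level}
    (K : CommutativeRing a b) → IsField K →
    (L : Ring c ℓ) → IsDivisionRing L →
    (E : CentralEmbedding K L) →
    let open CentralEmbedding E in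
    (∀ x → ¬ (x ∈ Image) → x ∈ Transcendental) →
    (A : Pred (Ring.Carrier L) p) (B : Pred (Ring.Carrier L) q) →
    IsSubspace A → IsSubspace B →
    Nonzero A → Nonzero B →
    (m n : ℕ) → HasDimension A m → HasDimension B n →
    (¬ ¬ FiniteDimensional ⟨ A · B ⟩) ×
    (∀ d → HasDimension ⟨ A · B ⟩ d → d ≥ m + n ∸ 1)
mainTheorem7 K K-field L L-div E trans-outside A B A-sub B-sub A≠0 B≠0 m n (e , e-basis) (f , f-basis) =
  product-finite e-basis f-basis ,
  -- `pair-size` gives m + n ≤ suc d; taking 1 from both sides leaves d on the right by computation.
  λ d (h , h-basis) → ℕ.∸-monoˡ-≤ 1
    (≡.subst₂ _≤_ (≡.cong₂ _+_ (length-tabulate e) (length-tabulate f)) (cong suc (length-tabulate h))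
      (pair-size trans-outside (bases-pair e-basis f-basis A-sub B-sub A≠0 B≠0 h-basis)))
  where open Growth K-field L-div E
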